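{- Let $n$ be an odd positive integer and let $r\ge 0$ be an integer such that $2^r < n$. Then $Q_n$ can be decomposed into paths of length $2^r$.
   Context: The $n$-dimensional hypercube $Q_n$ is the graph with vertex set $\{0,1\}^n$ in which two vertices $x,y$ are adjacent iff $\|x-y\|_1 = 1$. A path of length $k$ is a sequence of distinct vertices $x_1,\dots,x_{k+1}$ with $x_i x_{i+1}$ an edge for all $1\le i\le k$. A decomposition of a graph into paths of length $k$ is a collection of paths of length $k$ in the graph whose edge sets partition the edge set of the graph. -}

module Defs where

open import Data.Nat using (ℕ; suc)
open import Data.Bool using (Bool)
open import Data.Fin using (Fin; inject₁) renaming (suc to fsuc)
open import Data.Vec using (Vec; lookup)
import Data.Product
open Data.Product using (Σ; _×_; ∃; ∃-syntax)
open import Data.Sum using (_⊎_)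
open import Relation.Binary.PropositionalEquality using (_≡_; _≢_)

Vertex : ℕ → Set
Vertex n = Vec Bool n

Adjacent : {n : ℕ} → Vertex n → Vertex n → Set
Adjacent {n} x y =
  Σ (Fin n) λ i → (lookup x i ≢ lookup y i)
    × ((j : Fin n) → j ≢ i → lookup x j ≡ lookup y j)

record Path (n k : ℕ) : Set where
  field
    vertices : Vec (Vertex n) (suc k)
    distinct : (i j : Fin (suc k)) → lookup vertices i ≡ lookup vertices j → i ≡ j
    steps    : (i : Fin k) →
               Adjacent (lookup vertices (inject₁ i)) (lookup vertices (fsuc i))
open Path public

UsesEdge : {n k : ℕ} → Path n k → Fin k → Vertex n → Vertex n → Set
UsesEdge P i x y =
  (lookup (vertices P) (inject₁ i) ≡ x × lookup (vertices P) (fsuc i) ≡ y)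
  ⊎ (lookup (vertices P) (inject₁ i) ≡ y × lookup (vertices P) (fsuc i) ≡ x)

-- A decomposition of Q_n into paths of length k: a finite family of paths
-- whose edge sets partition E(Q_n): every edge {x,y} of Q_n is the edge
-- of exactly one path at exactly one position.
-- (Every edge of a path is an edge of Q_n by construction of Path.)
PathDecomposition : (n k m : ℕ) → Vec (Path n k) m → Set
PathDecomposition n k m Ps =
  (x y : Vertex n) → Adjacent x y →
    Σ (Fin m × Fin k) (λ p → UsesEdge (lookup Ps (Data.Product.proj₁ p)) (Data.Product.proj₂ p) x y)
    × ((p q : Fin m × Fin k) →
        UsesEdge (lookup Ps (Data.Product.proj₁ p)) (Data.Product.proj₂ p) x y →
        UsesEdge (lookup Ps (Data.Product.proj₁ q)) (Data.Product.proj₂ q) x y →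
        p ≡ q)

HasPathDecomposition : ℕ → ℕ → Set
HasPathDecomposition n k = ∃[ m ] Σ (Vec (Path n k) m) (PathDecomposition n k m)

{-# OPTIONS --safe #-}

-- Write n = 1 + 2(m + 1), so that Q_n consists of two copies of Q_{2(m+1)} joined by a perfect matching, and
-- identify Q_{2(m+1)} with the directed torus (ℤ/4)^{m+1}.  The arcs of the torus are partitioned into
-- permutations f_0, …, f_m of the vertices such that
--   (1) every trail v, f_0 v, f_1 f_0 v, …, f_m ⋯ f_0 v is a path, and
--   (2) every cycle of f_k has length divisible by 4^{k+1}.
-- For r ≥ 1 put A = 2^{r-1} and B = A - 1.  Each vertex v of the first copy starts a path of length
-- A + 1 + B = 2^r that follows f_0, …, f_{A-1}, crosses to the other copy, and follows f_0, …, f_{B-1} there.  The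
-- unused permutations have only cycles of length divisible by 4^{B+1}, hence by 2^{r+1}, and these are cut into
-- paths of length 2^r.  (For r = 0 take A = B = 0.)
--
-- The permutations come from the inductive step m → m + 1: at the vertices of digit sum 0 the new permutation
-- f_{m+1} acts as the old f_m and the new f_m increments the new digit; elsewhere the roles are exchanged.  All other
-- f_k are unchanged.  In terms of prefix sums of digits f_m on (ℤ/4)^{m+1} is an odometer, the source of (2).
module Submission where

open import Defs
open import Data.Bool using (Bool; true; false; not; if_then_else_; _∧_)
import Data.Bool.Properties as Bool
open import Data.Empty using (⊥; ⊥-elim)
open import Data.Fin using (Fin; zero; suc; toℕ; fromℕ<; inject₁)
import Data.Fin.Properties as Fin
open import Data.List using
  (List; []; _∷_; _++_; map; lookup; length; filter; deduplicate; cartesianProduct; upTo)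
open import Data.List.Membership.Propositional using (_∈_)
open import Data.List.Membership.Propositional.Properties
  using (∈-lookup; ∈-filter⁺; ∈-filter⁻; ∈-deduplicate⁺; ∈-map⁺; ∈-++⁺ˡ; ∈-++⁺ʳ; ∈-cartesianProduct⁺; ∈-upTo⁺)
open import Data.List.Relation.Unary.All using () renaming (lookup to All-lookup)
open import Data.List.Relation.Unary.AllPairs using ([]; _∷_)
open import Data.List.Relation.Unary.Any using (here; there; index)
open import Data.List.Relation.Unary.Any.Properties using (lookup-index)
open import Data.List.Relation.Unary.Unique.DecPropositional.Properties using (deduplicate-!)
open import Data.List.Relation.Unary.Unique.Propositional using (Unique)
open import Data.List.Relation.Unary.Unique.Propositional.Properties using (filter⁺)
open import Data.Maybe using (Maybe; just; nothing)
import Data.Maybe.Properties as Maybe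
open import Data.Nat
  using (ℕ; zero; suc; _+_; _*_; _^_; _/_; _%_; _≤_; _<_; _≤?_; _<?_; _≟_; z≤n; s≤s; NonZero)
open import Data.Nat.DivMod using (m≡m%n+[m/n]*n; [m+kn]%n≡m%n; m<n⇒m%n≡m; m%n<n; n%n≡0)
open import Data.Nat.Divisibility using (_∣_; divides; ∣-trans; n∣m*n; m∣m*n)
open import Data.Nat.GeneralisedArithmetic using (fold)
open import Data.Nat.Properties hiding (_≟_; _≤?_; _<?_)
open import Data.Nat.Tactic.RingSolver using (solve-∀)
open import Data.Product using (∃-syntax; _×_; _,_; proj₁; proj₂)
import Data.Product.Properties as Product
open import Data.Sum using (_⊎_; inj₁; inj₂) renaming (map to map⊎)
open import Data.Unit using (⊤; tt)
open import Data.Vec using ([]; _∷_; tabulate) renaming (lookup to lookupᵥ)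
import Data.Vec.Properties as Vec
open import Data.Vec.Relation.Binary.Pointwise.Extensional using (ext; Pointwise-≡⇒≡)
open import Function using (_∘_; case_of_)
open import Relation.Binary using (DecidableEquality; tri<; tri≈; tri>)
open import Relation.Binary.PropositionalEquality
open import Relation.Nullary using (¬_; Dec; yes; no; contradiction)
open import Relation.Nullary.Decidable using (_×-dec_; _→-dec_; toWitness)

-- Path decompositions from local data on arcs

lookup-injective : ∀ {A : Set} {xs : List A} → Unique xs → ∀ i j → lookup xs i ≡ lookup xs j → i ≡ j
lookup-injective (_ ∷ _) zero zero _ = refl
lookup-injective (x∉ ∷ _) zero (suc j) eq = contradiction eq (All-lookup x∉ (∈-lookup j))
lookup-injective (x∉ ∷ _) (suc i) zero eq = contradiction (sym eq) (All-lookup x∉ (∈-lookup i))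
lookup-injective (_ ∷ xs!) (suc i) (suc j) eq = cong suc (lookup-injective xs! i j eq)

Joins : ∀ {V : Set} → V → V → V → V → Set
Joins s t x y = (s ≡ x × t ≡ y) ⊎ (s ≡ y × t ≡ x)

-- A decomposition given by local data: `pos a` is the index of the edge `a` in its path, and `next`
-- and `prev` move along that path. The paths are recovered as the chains that start at position 0.
-- At the last position only the source of `next a` matters, as the final vertex.
record ArcDecomposition (n k : ℕ) : Set₁ where
  field
    Arc   : Set
    _≟ₐ_  : DecidableEquality Arc
    Valid : Arc → Set
    valid? : ∀ a → Dec (Valid a)
    arcs  : List Arc
    arcs-complete : ∀ {a} → Valid a → a ∈ arcs
    src   : Arc → Vertex n
    next prev : Arc → Arc
    pos   : Arc → ℕ

  -- Consecutive arcs share a vertex, so the target of an arc is the source of the next one.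
  tgt : Arc → Vertex n
  tgt a = src (next a)

  field
    adjacent : ∀ {a} → Valid a → Adjacent (src a) (tgt a)
    cover    : ∀ {x y} → Adjacent x y → ∃[ a ] Valid a × Joins (src a) (tgt a) x y
    unique   : ∀ {a b x y} → Valid a → Valid b →
               Joins (src a) (tgt a) x y → Joins (src b) (tgt b) x y → a ≡ b
    pos<k    : ∀ {a} → Valid a → pos a < k
    step     : ∀ {a} → Valid a → suc (pos a) < k →
               Valid (next a) × pos (next a) ≡ suc (pos a) × prev (next a) ≡ a
    back     : ∀ {a j} → Valid a → pos a ≡ suc j →
               Valid (prev a) × pos (prev a) ≡ j × next (prev a) ≡ a
    simple   : ∀ {a i j} → Valid a → pos a ≡ 0 → i ≤ k → j ≤ k →
               src (fold a next i) ≡ src (fold a next j) → i ≡ j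

module _ {n k : ℕ} (D : ArcDecomposition n k) where
  open ArcDecomposition D

  IsStart : Arc → Set
  IsStart a = Valid a × pos a ≡ 0

  isStart? : ∀ a → Dec (IsStart a)
  isStart? a = valid? a ×-dec (pos a ≟ 0)

  follow : ∀ {a} → IsStart a → ∀ {i} → i < k → Valid (fold a next i) × pos (fold a next i) ≡ i
  follow start {zero} _ = start
  follow {a} start {suc i} i<k with follow start {i} (<⇒≤ i<k)
  ... | v , p≡i with step v (subst (λ p → suc p < k) (sym p≡i) i<k)
  ...   | v′ , p≡ , _ = v′ , trans p≡ (cong suc p≡i)

  -- Before the last position `prev` undoes `next`, so two chains that meet after `i` steps can be
  -- walked back to a common start.
  follow-injective : ∀ {a b} → IsStart a → IsStart b → ∀ {i} → i < k →
                     fold a next i ≡ fold b next i → a ≡ b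
  follow-injective _ _ {zero} _ eq = eq
  follow-injective {a} {b} sa sb {suc i} i<k eq =
    follow-injective sa sb {i} (<⇒≤ i<k) (trans (sym (undo sa)) (trans (cong prev eq) (undo sb)))
    where
    undo : ∀ {c} → IsStart c → prev (fold c next (suc i)) ≡ fold c next i
    undo s with follow s {i} (<⇒≤ i<k)
    ... | v , p≡i = proj₂ (proj₂ (step v (subst (λ p → suc p < k) (sym p≡i) i<k)))

  trace : ∀ j {a} → Valid a → pos a ≡ j → ∃[ b ] IsStart b × fold b next j ≡ a
  trace zero    v p≡0 = _ , (v , p≡0) , refl
  trace (suc j) v p≡j with back v p≡j
  ... | v′ , p′ , eq with trace j v′ p′
  ...   | b , s , eq′ = b , s , trans (cong next eq′) eq

  starts : List Arc
  -- A start listed twice in `arcs` would yield the same path twice and break uniqueness.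
  starts = filter isStart? (deduplicate _≟ₐ_ arcs)

  starts-unique : Unique starts
  starts-unique = filter⁺ isStart? (deduplicate-! _≟ₐ_ arcs)

  start-∈ : ∀ {a} → IsStart a → a ∈ starts
  start-∈ s = ∈-filter⁺ isStart? (∈-deduplicate⁺ _≟ₐ_ (arcs-complete (proj₁ s))) s

  isStart : ∀ i → IsStart (lookup starts i)
  isStart i = proj₂ (∈-filter⁻ isStart? {xs = deduplicate _≟ₐ_ arcs} (∈-lookup i))

  vertex : Arc → Fin (suc k) → Vertex n
  vertex a i = src (fold a next (toℕ i))

  vertex-source : ∀ a i → lookupᵥ (tabulate (vertex a)) (inject₁ i) ≡ src (fold a next (toℕ i))
  vertex-source a i =
    trans (Vec.lookup∘tabulate (vertex a) (inject₁ i)) (cong (src ∘ fold a next) (Fin.toℕ-inject₁ i))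

  vertex-target : ∀ a i → lookupᵥ (tabulate (vertex a)) (suc i) ≡ tgt (fold a next (toℕ i))
  vertex-target a i = Vec.lookup∘tabulate (vertex a) (suc i)

  pathFrom : ∀ {a} → IsStart a → Path n k
  pathFrom {a} s = record
    { vertices = tabulate (vertex a)
    ; distinct = λ i j eq → Fin.toℕ-injective
        (simple (proj₁ s) (proj₂ s) (Fin.toℕ≤pred[n] i) (Fin.toℕ≤pred[n] j)
          (trans (sym (Vec.lookup∘tabulate (vertex a) i)) (trans eq (Vec.lookup∘tabulate (vertex a) j))))
    ; steps = λ i → subst₂ Adjacent (sym (vertex-source a i)) (sym (vertex-target a i))
        (adjacent (proj₁ (follow s (Fin.toℕ<n i))))
    }

  usesEdge⇒joins : ∀ {a} (s : IsStart a) i {x y} → UsesEdge (pathFrom s) i x y →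
                   Joins (src (fold a next (toℕ i))) (tgt (fold a next (toℕ i))) x y
  usesEdge⇒joins {a} s i =
    subst₂ (λ u v → Joins u v _ _) (vertex-source a i) (vertex-target a i)

  joins⇒usesEdge : ∀ {a} (s : IsStart a) i {x y} →
                   Joins (src (fold a next (toℕ i))) (tgt (fold a next (toℕ i))) x y →
                   UsesEdge (pathFrom s) i x y
  joins⇒usesEdge {a} s i =
    subst₂ (λ u v → Joins u v _ _) (sym (vertex-source a i)) (sym (vertex-target a i))

  arcDecomposition⇒pathDecomposition : HasPathDecomposition n k
  arcDecomposition⇒pathDecomposition =
    length starts , tabulate paths , λ x y xy → covered xy , λ p q → once p q
    where
    paths : Fin (length starts) → Path n k
    paths i = pathFrom (isStart i)

    covered : ∀ {x y} → Adjacent x y →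
              ∃[ p ] UsesEdge (lookupᵥ (tabulate paths) (proj₁ p)) (proj₂ p) x y
    covered {x} {y} xy with cover xy
    ... | a , v , joins with trace (pos a) v refl
    ...   | b , s , eq = (i , j) ,
            subst (λ P → UsesEdge P j x y) (sym (Vec.lookup∘tabulate paths i))
              (joins⇒usesEdge (isStart i) j (subst (λ c → Joins (src c) (tgt c) x y) (sym reached) joins))
      where
      i = index (start-∈ s)
      j = fromℕ< (pos<k v)
      reached : fold (lookup starts i) next (toℕ j) ≡ a
      reached =
        trans (cong₂ (λ c → fold c next) (sym (lookup-index (start-∈ s))) (Fin.toℕ-fromℕ< (pos<k v))) eq

    once : ∀ {x y} (p q : Fin (length starts) × Fin k) →
           UsesEdge (lookupᵥ (tabulate paths) (proj₁ p)) (proj₂ p) x y →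
           UsesEdge (lookupᵥ (tabulate paths) (proj₁ q)) (proj₂ q) x y → p ≡ q
    once {x} {y} (i , j) (i′ , j′) u u′ = cong₂ _,_ i≡i′ j≡j′
      where
      joins : ∀ i j → UsesEdge (lookupᵥ (tabulate paths) i) j x y →
              Joins (src (fold (lookup starts i) next (toℕ j)))
                    (tgt (fold (lookup starts i) next (toℕ j))) x y
      joins i j = usesEdge⇒joins (isStart i) j ∘ subst (λ P → UsesEdge P j x y) (Vec.lookup∘tabulate paths i)
      at : ∀ i (j : Fin k) → Valid (fold (lookup starts i) next (toℕ j)) ×
                             pos (fold (lookup starts i) next (toℕ j)) ≡ toℕ j
      at i j = follow (isStart i) (Fin.toℕ<n j)
      -- Both positions hold the same arc. Its `pos` determines the index within the path, and
      -- walking back determines the start.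
      same : fold (lookup starts i) next (toℕ j) ≡ fold (lookup starts i′) next (toℕ j′)
      same = unique (proj₁ (at i j)) (proj₁ (at i′ j′)) (joins i j u) (joins i′ j′ u′)
      j≡j′ : j ≡ j′
      j≡j′ = Fin.toℕ-injective (trans (sym (proj₂ (at i j))) (trans (cong pos same) (proj₂ (at i′ j′))))
      i≡i′ : i ≡ i′
      i≡i′ = lookup-injective starts-unique i i′ (follow-injective (isStart i) (isStart i′) (Fin.toℕ<n j)
               (trans same (cong (fold (lookup starts i′) next ∘ toℕ) (sym j≡j′))))

-- The permutations f_k

-- A digit is an element of ℤ/4 in Gray code, 0 = 00, 1 = 01, 2 = 11, 3 = 10, and rot adds 1.
Digit : Set
Digit = Bool × Bool

rot rot⁻¹ : Digit → Digit
rot   (a , b) = b , not a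
rot⁻¹ (a , b) = not b , a

add : Digit → Digit → Digit
add (false , false) s = s
add (false , true)  s = rot s
add (true  , true)  s = rot (rot s)
add (true  , false) s = rot⁻¹ s

isZero : Digit → Bool
isZero (a , b) = not a ∧ not b

rot-rot⁻¹ : ∀ d → rot (rot⁻¹ d) ≡ d
rot-rot⁻¹ (a , b) = cong (a ,_) (Bool.not-involutive b)

rot⁻¹-rot : ∀ d → rot⁻¹ (rot d) ≡ d
rot⁻¹-rot (a , b) = cong (_, b) (Bool.not-involutive a)

rot³ : ∀ s → rot (rot (rot s)) ≡ rot⁻¹ s
rot³ (a , b) = cong (λ c → not b , c) (Bool.not-involutive a)

add-rotˡ : ∀ d s → add (rot d) s ≡ rot (add d s)
add-rotˡ (false , false) s = refl
add-rotˡ (false , true)  s = refl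
add-rotˡ (true  , true)  s = sym (rot³ s)
add-rotˡ (true  , false) s = sym (rot-rot⁻¹ s)

add-rotʳ : ∀ d s → add d (rot s) ≡ rot (add d s)
add-rotʳ (false , false) s = refl
add-rotʳ (false , true)  s = refl
add-rotʳ (true  , true)  s = refl
add-rotʳ (true  , false) s = trans (rot⁻¹-rot s) (sym (rot-rot⁻¹ s))

rot-power-injective : ∀ d {i j} → i ≤ 3 → j ≤ 3 → fold d rot i ≡ fold d rot j → i ≡ j
rot-power-injective d {i} {j} i≤3 j≤3 eq =
  trans (sym i≡) (trans (cong toℕ (distinct-powers d (fromℕ< (s≤s i≤3)) (fromℕ< (s≤s j≤3))
    (subst₂ (λ i j → fold d rot i ≡ fold d rot j) (sym i≡) (sym j≡) eq))) j≡)
  where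
  i≡ = Fin.toℕ-fromℕ< (s≤s i≤3)
  j≡ = Fin.toℕ-fromℕ< (s≤s j≤3)
  distinct-powers? : ∀ d → Dec (∀ (i j : Fin 4) → fold d rot (toℕ i) ≡ fold d rot (toℕ j) → i ≡ j)
  distinct-powers? d = Fin.all? λ i → Fin.all? λ j →
    Product.≡-dec Bool._≟_ Bool._≟_ (fold d rot (toℕ i)) (fold d rot (toℕ j)) →-dec (i Fin.≟ j)
  distinct-powers : ∀ d (i j : Fin 4) → fold d rot (toℕ i) ≡ fold d rot (toℕ j) → i ≡ j
  distinct-powers (false , false) = toWitness {a? = distinct-powers? (false , false)} _
  distinct-powers (false , true)  = toWitness {a? = distinct-powers? (false , true)} _
  distinct-powers (true  , true)  = toWitness {a? = distinct-powers? (true , true)} _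
  distinct-powers (true  , false) = toWitness {a? = distinct-powers? (true , false)} _

digitSum : ∀ m → Vertex (m * 2) → Digit
digitSum zero    []          = false , false
digitSum (suc m) (a ∷ b ∷ u) = add (a , b) (digitSum m u)

infixr 5 _▹_
_▹_ : ∀ {n} → Digit → Vertex n → Vertex (2 + n)
(a , b) ▹ u = a ∷ b ∷ u

▹-injective : ∀ {n} d d′ {u u′ : Vertex n} → d ▹ u ≡ d′ ▹ u′ → d ≡ d′ × u ≡ u′
▹-injective _ _ refl = refl , refl

select : ∀ {A : Set} → ℕ → ℕ → A → A → A → A
select zero    zero    l e g = e
select zero    (suc k) l e g = g
select (suc m) zero    l e g = l
select (suc m) (suc k) l e g = select m k l e g

module _ {A : Set} {l e g : A} where
  select-< : ∀ {m k} → k < m → select m k l e g ≡ l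
  select-< {suc m} {zero}  _         = refl
  select-< {suc m} {suc k} (s≤s k<m) = select-< k<m

  select-≡ : ∀ m → select m m l e g ≡ e
  select-≡ zero    = refl
  select-≡ (suc m) = select-≡ m

  select-> : ∀ {m k} → m < k → select m k l e g ≡ g
  select-> {zero}  {suc k} _         = refl
  select-> {suc m} {suc k} (s≤s m<k) = select-> m<k

-- `true` means that the new digit moves, `false` that the step is left to the remaining digits.
turn : ℕ → ℕ → Digit → Bool
turn m k s = select m k false (isZero s) (not (isZero s))

-- The permutation f_k of (ℤ/4)^{m+1}.  The meaningful labels are k ≤ m; every k ≥ m gives f_m.
factor : ∀ m → ℕ → Vertex (suc m * 2) → Vertex (suc m * 2)
factor zero    k (a ∷ b ∷ []) = rot (a , b) ▹ []
factor (suc m) k (a ∷ b ∷ u)  =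
  if turn m k (digitSum (2 + m) (a ∷ b ∷ u)) then rot (a , b) ▹ u else (a , b) ▹ factor m k u

-- The branch was chosen by the digit sum of the preimage, which is one less than that of the
-- argument; hence the `rot⁻¹` in the test.
factor⁻¹ : ∀ m → ℕ → Vertex (suc m * 2) → Vertex (suc m * 2)
factor⁻¹ zero    k (a ∷ b ∷ []) = rot⁻¹ (a , b) ▹ []
factor⁻¹ (suc m) k (a ∷ b ∷ u)  =
  if turn m k (rot⁻¹ (digitSum (2 + m) (a ∷ b ∷ u)))
  then rot⁻¹ (a , b) ▹ u else (a , b) ▹ factor⁻¹ m k u

factor-turn : ∀ m k a b u → turn m k (digitSum (2 + m) (a ∷ b ∷ u)) ≡ true →
              factor (suc m) k (a ∷ b ∷ u) ≡ rot (a , b) ▹ u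
factor-turn m k a b u t rewrite t = refl

factor-lift : ∀ m k a b u → turn m k (digitSum (2 + m) (a ∷ b ∷ u)) ≡ false →
              factor (suc m) k (a ∷ b ∷ u) ≡ (a , b) ▹ factor m k u
factor-lift m k a b u t rewrite t = refl

-- Either branch increments exactly one digit. The digit sum is thus a clock that advances by one
-- per step whatever the label, which fixes the turns along a trail and makes them recoverable from
-- the image.
digitSum-factor : ∀ m k v → digitSum (suc m) (factor m k v) ≡ rot (digitSum (suc m) v)
digitSum-factor zero    k (a ∷ b ∷ []) = add-rotˡ (a , b) (false , false)
digitSum-factor (suc m) k (a ∷ b ∷ u) with turn m k (digitSum (2 + m) (a ∷ b ∷ u))
... | true  = add-rotˡ (a , b) (digitSum (suc m) u)
... | false = trans (cong (add (a , b)) (digitSum-factor m k u)) (add-rotʳ (a , b) (digitSum (suc m) u))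

factor⁻¹-turn : ∀ m k a b u → turn m k (rot⁻¹ (digitSum (2 + m) (a ∷ b ∷ u))) ≡ true →
                factor⁻¹ (suc m) k (a ∷ b ∷ u) ≡ rot⁻¹ (a , b) ▹ u
factor⁻¹-turn m k a b u t rewrite t = refl

factor⁻¹-lift : ∀ m k a b u → turn m k (rot⁻¹ (digitSum (2 + m) (a ∷ b ∷ u))) ≡ false →
                factor⁻¹ (suc m) k (a ∷ b ∷ u) ≡ (a , b) ▹ factor⁻¹ m k u
factor⁻¹-lift m k a b u t rewrite t = refl

factor⁻¹-factor : ∀ m k v → factor⁻¹ m k (factor m k v) ≡ v
factor⁻¹-factor zero    k (a ∷ b ∷ []) = cong (_▹ []) (rot⁻¹-rot (a , b))
factor⁻¹-factor (suc m) k v@(a ∷ b ∷ u) with turn m k (digitSum (2 + m) v) in t | digitSum-factor (suc m) k v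
... | true  | s =
      trans (factor⁻¹-turn m k b (not a) u
        (trans (cong (turn m k ∘ rot⁻¹) s) (trans (cong (turn m k) (rot⁻¹-rot (digitSum (2 + m) v))) t)))
                        (cong (_▹ u) (rot⁻¹-rot (a , b)))
... | false | s =
      trans (factor⁻¹-lift m k a b (factor m k u)
        (trans (cong (turn m k ∘ rot⁻¹) s) (trans (cong (turn m k) (rot⁻¹-rot (digitSum (2 + m) v))) t)))
                        (cong ((a , b) ▹_) (factor⁻¹-factor m k u))

add-rot⁻¹ˡ : ∀ d s → add (rot⁻¹ d) s ≡ rot⁻¹ (add d s)
add-rot⁻¹ˡ d s =
  trans (sym (rot⁻¹-rot _)) (cong rot⁻¹
    (trans (sym (add-rotˡ (rot⁻¹ d) s)) (cong (λ d → add d s) (rot-rot⁻¹ d))))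

add-rot⁻¹ʳ : ∀ d s → add d (rot⁻¹ s) ≡ rot⁻¹ (add d s)
add-rot⁻¹ʳ d s =
  trans (sym (rot⁻¹-rot _)) (cong rot⁻¹ (trans (sym (add-rotʳ d (rot⁻¹ s))) (cong (add d) (rot-rot⁻¹ s))))

digitSum-factor⁻¹ : ∀ m k v → digitSum (suc m) (factor⁻¹ m k v) ≡ rot⁻¹ (digitSum (suc m) v)
digitSum-factor⁻¹ zero    k (a ∷ b ∷ []) = add-rot⁻¹ˡ (a , b) (false , false)
digitSum-factor⁻¹ (suc m) k (a ∷ b ∷ u) with turn m k (rot⁻¹ (digitSum (2 + m) (a ∷ b ∷ u)))
... | true  = add-rot⁻¹ˡ (a , b) (digitSum (suc m) u)
... | false = trans (cong (add (a , b)) (digitSum-factor⁻¹ m k u)) (add-rot⁻¹ʳ (a , b) (digitSum (suc m) u))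

factor-factor⁻¹ : ∀ m k v → factor m k (factor⁻¹ m k v) ≡ v
factor-factor⁻¹ zero    k (a ∷ b ∷ []) = cong (_▹ []) (rot-rot⁻¹ (a , b))
factor-factor⁻¹ (suc m) k v@(a ∷ b ∷ u)
  with turn m k (rot⁻¹ (digitSum (2 + m) v)) in t | digitSum-factor⁻¹ (suc m) k v
... | true  | s =
      trans (factor-turn m k (not b) a u (trans (cong (turn m k) s) t)) (cong (_▹ u) (rot-rot⁻¹ (a , b)))
... | false | s =
      trans (factor-lift m k a b (factor⁻¹ m k u) (trans (cong (turn m k) s) t))
        (cong ((a , b) ▹_) (factor-factor⁻¹ m k u))

-- In its lifted branch f_{m+1} calls `factor m (suc m)`; this saturation is what makes it act there
-- as the old f_m.
factor-top : ∀ m δ v → factor m (δ + m) v ≡ factor m m v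
factor-top zero    δ (a ∷ b ∷ []) = refl
factor-top (suc m) δ v@(a ∷ b ∷ u) = cong₂ (λ t w → if t then rot (a , b) ▹ u else (a , b) ▹ w)
  (trans (select-> {l = false} (m≤n+m (suc m) δ)) (sym (select-> {l = false} {m = m} ≤-refl)))
  (trans (cong (λ k → factor m k u) (+-suc δ m)) (trans (factor-top m (suc δ) u) (sym (factor-top m 1 u))))

-- Trails

trail : ∀ m → Vertex (suc m * 2) → ℕ → Vertex (suc m * 2)
trail m v zero    = v
trail m v (suc j) = factor m j (trail m v j)

module _ (m : ℕ) (d : Digit) (u : Vertex (suc m * 2)) where

  private
    T : ℕ → Vertex ((2 + m) * 2)
    T = trail (suc m) (d ▹ u)

  -- After j steps the new digit has been incremented e times and the other digits have made h steps of
  -- their own trail.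
  record At (j e h : ℕ) : Set where
    constructor mkAt
    field at-≡ : T j ≡ fold d rot e ▹ trail m u h
  open At public

  at-turn : ∀ {j e h} → At j e h → turn m j (digitSum (2 + m) (T j)) ≡ true → At (suc j) (suc e) h
  at-turn {j} {e} {h} (mkAt at) t = mkAt (trans (cong (factor (suc m) j) at)
    (factor-turn m j _ _ (trail m u h) (trans (cong (turn m j ∘ digitSum (2 + m)) (sym at)) t)))

  at-lift : ∀ {j e h} → At j e h → turn m j (digitSum (2 + m) (T j)) ≡ false →
            factor m j (trail m u h) ≡ factor m h (trail m u h) → At (suc j) e (suc h)
  at-lift {j} {e} {h} (mkAt at) t eq = mkAt (trans (cong (factor (suc m) j) at)
    (trans (factor-lift m j _ _ (trail m u h) (trans (cong (turn m j ∘ digitSum (2 + m)) (sym at)) t))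
           (cong (fold d rot e ▹_) eq)))

  at-low : ∀ {j} → j ≤ m → At j 0 j
  at-low {zero}  _   = mkAt refl
  at-low {suc j} j<m = at-lift (at-low (<⇒≤ j<m)) (select-< j<m) refl

  Located : ℕ → Set
  Located j = ∃[ e ] ∃[ h ] e + h ≡ j × e ≤ 3 × h ≤ 2 + m × At j e h

  private
    located : ∀ {δ} e x → e + x ≡ δ → e ≤ 3 → x ≤ 2 → At (δ + m) e (x + m) → Located (δ + m)
    located e x refl e≤3 x≤2 at = e , x + m , sym (+-assoc e x m) , e≤3 , +-monoˡ-≤ m x≤2 , at

    sum : ∀ {s} → digitSum (2 + m) (T m) ≡ s → ∀ δ → digitSum (2 + m) (T (δ + m)) ≡ fold s rot δ
    sum s zero    = s
    sum s (suc δ) = trans (digitSum-factor (suc m) (δ + m) (T (δ + m))) (cong rot (sum s δ))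

    at-turn₀ : ∀ {s e h} → digitSum (2 + m) (T m) ≡ s → At m e h → isZero s ≡ true → At (suc m) (suc e) h
    at-turn₀ s at z = at-turn at (trans (cong (turn m m) s) (trans (select-≡ m) z))

    at-lift₀ : ∀ {s} → digitSum (2 + m) (T m) ≡ s → At m 0 m → isZero s ≡ false → At (suc m) 0 (suc m)
    at-lift₀ s at z = at-lift at (trans (cong (turn m m) s) (trans (select-≡ m) z)) refl

    at-turn₊ : ∀ {s e h} δ → digitSum (2 + m) (T m) ≡ s → At (suc δ + m) e h →
               isZero (fold s rot (suc δ)) ≡ false →
               At (2 + δ + m) (suc e) h
    at-turn₊ δ s at z = at-turn at (trans (cong (turn m (suc δ + m)) (sum s (suc δ)))
      (trans (select-> {l = false} (s≤s (m≤n+m m δ))) (cong not z)))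

    -- The outer label `suc δ + m` and the inner step count `x + m` may differ after a turn, but
    -- both are at least `m`, where `factor m` no longer depends on the label.
    at-lift₊ : ∀ {s e} δ x → digitSum (2 + m) (T m) ≡ s → At (suc δ + m) e (x + m) →
               isZero (fold s rot (suc δ)) ≡ true →
               At (2 + δ + m) e (suc x + m)
    at-lift₊ δ x s at z = at-lift at (trans (cong (turn m (suc δ + m)) (sum s (suc δ)))
      (trans (select-> {l = false} (s≤s (m≤n+m m δ))) (cong not z)))
      (trans (factor-top m (suc δ) _) (sym (factor-top m x _)))

    -- The last three steps depend only on the digit sum before them; at most two of them are lifted.
    top : Located (1 + m) × Located (2 + m) × Located (3 + m)
    top with digitSum (2 + m) (T m) in s
    ... | false , false =
      located 1 0 refl (s≤s z≤n) z≤n p₁ ,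
      located 2 0 refl (s≤s (s≤s z≤n)) z≤n p₂ ,
      located 3 0 refl ≤-refl z≤n p₃
      where
      p₁ : At (1 + m) 1 m
      p₁ = at-turn₀ s (at-low ≤-refl) refl
      p₂ : At (2 + m) 2 m
      p₂ = at-turn₊ 0 s p₁ refl
      p₃ : At (3 + m) 3 m
      p₃ = at-turn₊ 1 s p₂ refl
    ... | false , true =
      located 0 1 refl z≤n (s≤s z≤n) p₁ ,
      located 1 1 refl (s≤s z≤n) (s≤s z≤n) p₂ ,
      located 2 1 refl (s≤s (s≤s z≤n)) (s≤s z≤n) p₃
      where
      p₁ : At (1 + m) 0 (1 + m)
      p₁ = at-lift₀ s (at-low ≤-refl) refl
      p₂ : At (2 + m) 1 (1 + m)
      p₂ = at-turn₊ 0 s p₁ refl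
      p₃ : At (3 + m) 2 (1 + m)
      p₃ = at-turn₊ 1 s p₂ refl
    ... | true , true =
      located 0 1 refl z≤n (s≤s z≤n) p₁ ,
      located 1 1 refl (s≤s z≤n) (s≤s z≤n) p₂ ,
      located 1 2 refl (s≤s z≤n) ≤-refl p₃
      where
      p₁ : At (1 + m) 0 (1 + m)
      p₁ = at-lift₀ s (at-low ≤-refl) refl
      p₂ : At (2 + m) 1 (1 + m)
      p₂ = at-turn₊ 0 s p₁ refl
      p₃ : At (3 + m) 1 (2 + m)
      p₃ = at-lift₊ 1 1 s p₂ refl
    ... | true , false =
      located 0 1 refl z≤n (s≤s z≤n) p₁ ,
      located 0 2 refl z≤n ≤-refl p₂ ,
      located 1 2 refl (s≤s z≤n) ≤-refl p₃
      where
      p₁ : At (1 + m) 0 (1 + m)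
      p₁ = at-lift₀ s (at-low ≤-refl) refl
      p₂ : At (2 + m) 0 (2 + m)
      p₂ = at-lift₊ 0 1 s p₁ refl
      p₃ : At (3 + m) 1 (2 + m)
      p₃ = at-turn₊ 1 s p₂ refl

  locate : ∀ {j} → j ≤ 3 + m → Located j
  locate {j} j≤ with m≤n⇒m<n∨m≡n j≤
  ... | inj₂ refl = proj₂ (proj₂ top)
  ... | inj₁ (s≤s j≤₂) with m≤n⇒m<n∨m≡n j≤₂
  ...   | inj₂ refl = proj₁ (proj₂ top)
  ...   | inj₁ (s≤s j≤₁) with m≤n⇒m<n∨m≡n j≤₁
  ...     | inj₂ refl = proj₁ top
  ...     | inj₁ (s≤s j≤m) = 0 , j , refl , z≤n , m≤n⇒m≤o+n 2 j≤m , at-low j≤m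

-- By `locate`, the new digit of a vertex determines `e` (at most 3, below the order of `rot`), the
-- other digits determine `h` by induction, and the index is `e + h`. The bound allows one step more
-- than there are labels, the extra step repeating f_m: `2 + m` steps in the larger torus may all be
-- lifted, so a bound of `1 + m` would not pass through the induction.
trail-injective : ∀ m v {i j} → i ≤ 2 + m → j ≤ 2 + m → trail m v i ≡ trail m v j → i ≡ j
trail-injective zero v@(a ∷ b ∷ []) {i} {j} i≤ j≤ eq =
  rot-power-injective (a , b) (m≤n⇒m≤1+n i≤) (m≤n⇒m≤1+n j≤)
    (proj₁ (▹-injective _ _ (trans (sym (at i)) (trans eq (at j)))))
  where
  at : ∀ j → trail zero v j ≡ fold (a , b) rot j ▹ []
  at zero    = refl
  at (suc j) = cong (factor zero j) (at j)
trail-injective (suc m) (a ∷ b ∷ u) i≤ j≤ eq with locate m (a , b) u i≤ | locate m (a , b) u j≤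
... | e , h , refl , e≤ , h≤ , mkAt at | e′ , h′ , refl , e≤′ , h≤′ , mkAt at′
  with ▹-injective _ _ (trans (sym at) (trans eq at′))
... | d≡ , u≡ = cong₂ _+_ (rot-power-injective (a , b) e≤ e≤′ d≡) (trail-injective m u h≤ h≤′ u≡)

-- Every arc of the torus carries exactly one label

Succ : ∀ m → Vertex (m * 2) → Vertex (m * 2) → Set
Succ zero    _           _              = ⊥
Succ (suc m) (a ∷ b ∷ u) (a′ ∷ b′ ∷ u′) =
  ((a′ , b′) ≡ rot (a , b) × u ≡ u′) ⊎ ((a , b) ≡ (a′ , b′) × Succ m u u′)

factor-succ : ∀ m k v → Succ (suc m) v (factor m k v)
factor-succ zero    k (a ∷ b ∷ []) = inj₁ (refl , refl)
factor-succ (suc m) k (a ∷ b ∷ u) with turn m k (digitSum (2 + m) (a ∷ b ∷ u))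
... | true  = inj₁ (refl , refl)
... | false = inj₂ (refl , factor-succ m k u)

rot≢id : ∀ d → rot d ≢ d
rot≢id (false , false) ()
rot≢id (false , true)  ()
rot≢id (true  , true)  ()
rot≢id (true  , false) ()

rot²≢id : ∀ d → rot (rot d) ≢ d
rot²≢id (false , _) ()
rot²≢id (true  , _) ()

succ-irrefl : ∀ m {v} → ¬ Succ m v v
succ-irrefl (suc m) {a ∷ b ∷ u} (inj₁ (eq , _)) = rot≢id (a , b) (sym eq)
succ-irrefl (suc m) {a ∷ b ∷ u} (inj₂ (_ , s))  = succ-irrefl m s

-- Two increments of one digit do not cancel, since 2 is nonzero modulo 4, and increments of
-- different digits never do. Hence an edge of the cube carries only one orientation.
succ-asym : ∀ m {v w} → Succ m v w → ¬ Succ m w v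
succ-asym (suc m) {a ∷ b ∷ u} {a′ ∷ b′ ∷ u′} (inj₁ (refl , _)) (inj₁ (eq , _)) = rot²≢id (a , b) (sym eq)
succ-asym (suc m) {a ∷ b ∷ u} {a′ ∷ b′ ∷ u′} (inj₁ (_ , refl)) (inj₂ (_ , s)) = succ-irrefl m s
succ-asym (suc m) {a ∷ b ∷ u} {a′ ∷ b′ ∷ u′} (inj₂ (_ , s)) (inj₁ (_ , refl)) = succ-irrefl m s
succ-asym (suc m) {a ∷ b ∷ u} {a′ ∷ b′ ∷ u′} (inj₂ (_ , s)) (inj₂ (_ , s′)) = succ-asym m s s′

isZero? : ∀ s → isZero s ≡ true ⊎ isZero s ≡ false
isZero? (false , false) = inj₁ refl
isZero? (false , true)  = inj₂ refl
isZero? (true  , _)     = inj₂ refl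

turn-middle : ∀ m s {z} → isZero s ≡ z → turn m m s ≡ z
turn-middle m s = trans (select-≡ m)

turn-top : ∀ m s {z} → isZero s ≡ z → turn m (suc m) s ≡ not z
turn-top m s z = trans (select-> {l = false} {e = isZero s} {m = m} ≤-refl) (cong not z)

-- An arc that moves the new digit gets whichever of `m` and `suc m` turns at `v`. An arc of the old
-- digits keeps its old label, except that the old top label `m` becomes whichever of the two does
-- not turn.
succ-factor : ∀ m {v w} → Succ (suc m) v w → ∃[ k ] k ≤ m × factor m k v ≡ w
succ-factor zero    {a ∷ b ∷ []} {a′ ∷ b′ ∷ []} (inj₁ (refl , _)) = 0 , z≤n , refl
succ-factor (suc m) {v@(a ∷ b ∷ u)} {a′ ∷ b′ ∷ .u} (inj₁ (refl , refl)) with isZero? (digitSum (2 + m) v)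
... | inj₁ z = m , n≤1+n m , factor-turn m m a b u (turn-middle m (digitSum (2 + m) v) z)
... | inj₂ z = suc m , ≤-refl , factor-turn m (suc m) a b u (turn-top m (digitSum (2 + m) v) z)
succ-factor (suc m) {v@(a ∷ b ∷ u)} {a′ ∷ b′ ∷ u′} (inj₂ (refl , s)) with succ-factor m s
... | k , k≤m , eq with m≤n⇒m<n∨m≡n k≤m
...   | inj₁ k<m = k , m≤n⇒m≤1+n k≤m , trans (factor-lift m k a b u (select-< k<m)) (cong ((a , b) ▹_) eq)
...   | inj₂ refl with isZero? (digitSum (2 + m) v)
...     | inj₁ z = suc m , ≤-refl , trans (factor-lift m (suc m) a b u (turn-top m (digitSum (2 + m) v) z))
                                         (cong ((a , b) ▹_) (trans (factor-top m 1 u) eq))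
...     | inj₂ z =
      m , n≤1+n m , trans (factor-lift m m a b u (turn-middle m (digitSum (2 + m) v) z))
        (cong ((a , b) ▹_) eq)

turn-injective : ∀ m {k k′} s → k ≤ suc m → k′ ≤ suc m →
                 turn m k s ≡ true → turn m k′ s ≡ true → k ≡ k′
turn-injective zero    {zero}        {zero}        s _ _ _ _ = refl
turn-injective zero    {zero}        {suc k′}      s _ _ t t′ =
  contradiction (trans (cong not (sym t)) t′) λ ()
turn-injective zero    {suc k}       {zero}        s _ _ t t′ =
  contradiction (trans (cong not (sym t′)) t) λ ()
turn-injective zero    {suc zero}    {suc zero}    s _ _ _ _ = refl
turn-injective zero    {suc (suc _)} {_}           s (s≤s ()) _ _ _
turn-injective zero    {suc _} {suc (suc _)}       s _ (s≤s ()) _ _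
turn-injective (suc m) {suc k} {suc k′} s (s≤s k≤) (s≤s k′≤) t t′ = cong suc (turn-injective m s k≤ k′≤ t t′)

-- At most one label turns, a turn differs from a lift in the new digit, and two lifts are compared
-- by induction.
factor-injective : ∀ m v {k k′} → k ≤ m → k′ ≤ m → factor m k v ≡ factor m k′ v → k ≡ k′
factor-injective zero    v z≤n z≤n _ = refl
factor-injective (suc m) v@(a ∷ b ∷ u) {k} {k′} k≤ k′≤ eq
  with turn m k (digitSum (2 + m) v) in t | turn m k′ (digitSum (2 + m) v) in t′
... | true  | true  = turn-injective m (digitSum (2 + m) v) k≤ k′≤ t t′
... | true  | false = contradiction (proj₁ (▹-injective _ _ eq)) (rot≢id (a , b))
... | false | true  = contradiction (sym (proj₁ (▹-injective _ _ eq))) (rot≢id (a , b))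
... | false | false = go (m≤n⇒m<n∨m≡n k≤) (m≤n⇒m<n∨m≡n k′≤) t t′ (proj₂ (▹-injective (a , b) (a , b) eq))
  where
  -- Labels `m` and `suc m` both lift to the old f_m, but they have opposite turns and so are never
  -- lifted at the same vertex.
  top≢m : ∀ s → turn m (suc m) s ≡ false → turn m m s ≡ false → ⊥
  top≢m s t t′ = contradiction
    (trans (sym t) (trans (select-> {l = false} {e = isZero s} {m = m} ≤-refl)
      (cong not (trans (sym (select-≡ m)) t′)))) λ ()
  go : ∀ {k k′} → k < suc m ⊎ k ≡ suc m → k′ < suc m ⊎ k′ ≡ suc m →
       turn m k (digitSum (2 + m) v) ≡ false → turn m k′ (digitSum (2 + m) v) ≡ false →
       factor m k u ≡ factor m k′ u → k ≡ k′
  go (inj₁ (s≤s k≤)) (inj₁ (s≤s k′≤)) _ _ eq = factor-injective m u k≤ k′≤ eq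
  go (inj₂ refl) (inj₂ refl) _ _ _ = refl
  go (inj₁ (s≤s k≤)) (inj₂ refl) t t′ eq with factor-injective m u k≤ ≤-refl (trans eq (factor-top m 1 u))
  ... | refl = ⊥-elim (top≢m (digitSum (2 + m) v) t′ t)
  go (inj₂ refl) (inj₁ (s≤s k≤)) t t′ eq with factor-injective m u k≤ ≤-refl
    (trans (sym eq) (factor-top m 1 u))
  ... | refl = ⊥-elim (top≢m (digitSum (2 + m) v) t t′)

-- Adjacency in the cube and arcs of the torus

lookup-ext : ∀ {n} {x y : Vertex n} → (∀ i → lookupᵥ x i ≡ lookupᵥ y i) → x ≡ y
lookup-ext h = Pointwise-≡⇒≡ (ext h)

Adjacent-∷ : ∀ {n} {a} {x y : Vertex n} → Adjacent x y → Adjacent (a ∷ x) (a ∷ y)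
Adjacent-∷ (i , ≢ , ≡s) = suc i , ≢ , λ { zero _ → refl ; (suc j) j≢ → ≡s j (j≢ ∘ cong suc) }

Adjacent-head : ∀ {n a b} {x : Vertex n} → a ≢ b → Adjacent (a ∷ x) (b ∷ x)
Adjacent-head a≢b = zero , a≢b , λ { zero 0≢0 → contradiction refl 0≢0 ; (suc j) _ → refl }

Adjacent-uncons : ∀ {n a b} {x y : Vertex n} → Adjacent (a ∷ x) (b ∷ y) →
                  (a ≢ b × x ≡ y) ⊎ (a ≡ b × Adjacent x y)
Adjacent-uncons (zero  , a≢b , ≡s) = inj₁ (a≢b , lookup-ext λ i → ≡s (suc i) λ ())
Adjacent-uncons (suc i , ≢ , ≡s) =
  inj₂ (≡s zero (λ ()) , i , ≢ , λ j j≢i → ≡s (suc j) (j≢i ∘ Fin.suc-injective))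

succ⇒adjacent : ∀ m {v w} → Succ m v w → Adjacent v w
succ⇒adjacent (suc m) {false ∷ false ∷ u} {_ ∷ _ ∷ _} (inj₁ (refl , refl)) = Adjacent-∷ (Adjacent-head λ ())
succ⇒adjacent (suc m) {false ∷ true  ∷ u} {_ ∷ _ ∷ _} (inj₁ (refl , refl)) = Adjacent-head λ ()
succ⇒adjacent (suc m) {true  ∷ false ∷ u} {_ ∷ _ ∷ _} (inj₁ (refl , refl)) = Adjacent-head λ ()
succ⇒adjacent (suc m) {true  ∷ true  ∷ u} {_ ∷ _ ∷ _} (inj₁ (refl , refl)) = Adjacent-∷ (Adjacent-head λ ())
succ⇒adjacent (suc m) {_ ∷ _ ∷ u} {_ ∷ _ ∷ _} (inj₂ (refl , s)) = Adjacent-∷ (Adjacent-∷ (succ⇒adjacent m s))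

-- Flipping one bit of a Gray-coded digit changes it by 1 or -1 modulo 4; the sign is the direction
-- of the arc.
adjacent⇒succ : ∀ m {v w} → Adjacent v w → Succ m v w ⊎ Succ m w v
adjacent⇒succ zero    (() , _)
adjacent⇒succ (suc m) {a ∷ b ∷ u} {a′ ∷ b′ ∷ u′} adj with Adjacent-uncons adj
adjacent⇒succ (suc m) {a ∷ b ∷ u} {a′ ∷ .b ∷ .u} adj | inj₁ (a≢a′ , refl) with a | a′ | b
... | false | false | _     = contradiction refl a≢a′
... | true  | true  | _     = contradiction refl a≢a′
... | false | true  | true  = inj₁ (inj₁ (refl , refl))
... | false | true  | false = inj₂ (inj₁ (refl , refl))
... | true  | false | false = inj₁ (inj₁ (refl , refl))
... | true  | false | true  = inj₂ (inj₁ (refl , refl))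
adjacent⇒succ (suc m) {a ∷ b ∷ u} {.a ∷ b′ ∷ u′} adj | inj₂ (refl , adj′) with Adjacent-uncons adj′
... | inj₂ (refl , adj″) = map⊎ (λ s → inj₂ (refl , s)) (λ s → inj₂ (refl , s)) (adjacent⇒succ m adj″)
... | inj₁ (b≢b′ , refl) with a | b | b′
...   | _     | false | false = contradiction refl b≢b′
...   | _     | true  | true  = contradiction refl b≢b′
...   | false | false | true  = inj₁ (inj₁ (refl , refl))
...   | false | true  | false = inj₂ (inj₁ (refl , refl))
...   | true  | true  | false = inj₁ (inj₁ (refl , refl))
...   | true  | false | true  = inj₂ (inj₁ (refl , refl))

-- Phases: functions that increase by 1 modulo 4^{k+1} along f_k, so that its cycles are long

-- Multiples are added on both sides, which avoids subtraction in `ℕ`.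
_≡_[mod_] : ℕ → ℕ → ℕ → Set
a ≡ b [mod q ] = ∃[ c ] ∃[ d ] a + c * q ≡ b + d * q

-- third j = (4 ^ j - 1) / 3 = -1/3 modulo 4 ^ j
third : ℕ → ℕ
third zero    = 0
third (suc j) = 1 + 4 * third j

third-spec : ∀ j → 1 + 3 * third j ≡ 4 ^ j
third-spec zero    = refl
third-spec (suc j) = trans (lemma (third j)) (cong (4 *_) (third-spec j))
  where
  lemma : ∀ t → 1 + 3 * (1 + 4 * t) ≡ 4 * (1 + 3 * t)
  lemma = solve-∀

value : Digit → ℕ
value (false , false) = 0
value (false , true)  = 1
value (true  , true)  = 2
value (true  , false) = 3

value-rot : ∀ s → isZero s ≡ false → value s ≡ suc (value (rot⁻¹ s))
value-rot (false , true)  _ = refl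
value-rot (true  , true)  _ = refl
value-rot (true  , false) _ = refl

value-wrap : ∀ s → isZero s ≡ true → value s ≡ 0 × value (rot⁻¹ s) ≡ 3
value-wrap (false , false) _ = refl , refl

-- The digit sum less one, so that the exceptional step at digit sum 0 is the one at which the lag
-- wraps from 3 to 0.
lag : ∀ m → Vertex (suc m * 2) → ℕ
lag m v = value (rot⁻¹ (digitSum (suc m) v))

lag-factor : ∀ m k v → lag m (factor m k v) ≡ value (digitSum (suc m) v)
lag-factor m k v = cong value (trans (cong rot⁻¹ (digitSum-factor m k v)) (rot⁻¹-rot (digitSum (suc m) v)))

-- Let N be the odometer value of the old digits and τ the lag.  The new f_m increments N and τ, or takes τ from 3
-- to 0 and leaves N alone, so the coefficients of N and τ solve α + β = 1 and -3 β = 1 modulo 4^{m+1}.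
mixed : ℕ → ℕ → ℕ → ℕ
mixed t N τ = (2 + 2 * t) * N + t * τ

-- The value for the top label is a base-4 odometer: the lag is its lowest digit, and the old top
-- phase receives the carry, because f_{m+1} acts as the old f_m exactly when the lag wraps.
phase : ∀ m → ℕ → Vertex (suc m * 2) → ℕ
phase zero    k (a ∷ b ∷ []) = value (a , b)
phase (suc m) k (a ∷ b ∷ u)  = select m k
  (phase m k u)
  (mixed (third (suc m)) (phase m m u) (lag (suc m) (a ∷ b ∷ u)))
  (4 * phase m m u + lag (suc m) (a ∷ b ∷ u))

value-step : ∀ d → value (rot d) ≡ suc (value d) [mod 4 ]
value-step (false , false) = 0 , 0 , refl
value-step (false , true)  = 0 , 0 , refl
value-step (true  , true)  = 0 , 0 , refl
value-step (true  , false) = 1 , 0 , refl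

-- Here `N` stays and the lag falls from 3 to 0, a change of `-3 t`, which is 1 modulo `q`.
wrap-identity : ∀ t N q → 1 + 3 * t ≡ q → mixed t N 0 + 1 * q ≡ suc (mixed t N 3) + 0 * q
wrap-identity t N _ refl = lemma t N
  where
  lemma : ∀ t N → (2 + 2 * t) * N + t * 0 + 1 * (1 + 3 * t) ≡ suc ((2 + 2 * t) * N + t * 3) + 0
  lemma = solve-∀

-- Both `N` and the lag grow by one, a change of `(2 + 2 * t) + t = 1 + q`; the surplus `q` is the 1
-- in the right-hand witness.
step-identity : ∀ t N N′ τ c d q → 1 + 3 * t ≡ q → N′ + c * q ≡ suc N + d * q →
  mixed t N′ (suc τ) + ((2 + 2 * t) * c) * q ≡ suc (mixed t N τ) + (1 + (2 + 2 * t) * d) * q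
step-identity t N N′ τ c d q refl eq =
  trans (l t N′ τ c) (trans (cong (λ x → (2 + 2 * t) * x + t * suc τ) eq) (r t N τ d))
  where
  l : ∀ t N′ τ c → (2 + 2 * t) * N′ + t * suc τ + ((2 + 2 * t) * c) * (1 + 3 * t) ≡
      (2 + 2 * t) * (N′ + c * (1 + 3 * t)) + t * suc τ
  l = solve-∀
  r : ∀ t N τ d → (2 + 2 * t) * (suc N + d * (1 + 3 * t)) + t * suc τ ≡
      suc ((2 + 2 * t) * N + t * τ) + (1 + (2 + 2 * t) * d) * (1 + 3 * t)
  r = solve-∀

-- Multiplying the congruence for `N` by 4 also multiplies its modulus by 4, so each new dimension
-- gains a factor 4 in the cycle length.
carry-identity : ∀ N N′ c d q → N′ + c * q ≡ suc N + d * q →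
                 4 * N′ + 0 + c * (4 * q) ≡ suc (4 * N + 3) + d * (4 * q)
carry-identity N N′ c d q eq = trans (l N′ c q) (trans (cong (4 *_) eq) (r N d q))
  where
  l : ∀ N′ c q → 4 * N′ + 0 + c * (4 * q) ≡ 4 * (N′ + c * q)
  l = solve-∀
  r : ∀ N d q → 4 * (suc N + d * q) ≡ suc (4 * N + 3) + d * (4 * q)
  r = solve-∀

-- For `k < m` both the permutation and its phase are inherited. Labels `m` and `suc m` are split by
-- whether the digit sum is 0, that is, whether the lag wraps.
phase-factor : ∀ m {k} → k ≤ m → ∀ v → phase m k (factor m k v) ≡ suc (phase m k v) [mod 4 ^ suc k ]
phase-factor zero    z≤n (a ∷ b ∷ []) = value-step (a , b)
phase-factor (suc m) {k} k≤ v@(a ∷ b ∷ u) with <-cmp k m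
... | tri< k<m _ _ = subst₂ (_≡_[mod 4 ^ suc k ])
  (sym (trans (cong (phase (suc m) k) (factor-lift m k a b u (select-< k<m))) (select-< k<m)))
  (cong suc (sym (select-< k<m)))
  (phase-factor m (<⇒≤ k<m) u)
... | tri≈ _ refl _ = subst₂ (_≡_[mod 4 ^ suc m ]) refl (cong suc (sym (select-≡ m))) (middle (isZero? s))
  where
  s = digitSum (2 + m) v
  t = third (suc m)
  N = phase m m u
  phase-middle : ∀ {a b u} → factor (suc m) m v ≡ a ∷ b ∷ u →
                 phase (suc m) m (factor (suc m) m v) ≡ mixed t (phase m m u) (value s)
  phase-middle {a} {b} {u} eq = trans (cong (phase (suc m) m) eq) (trans (select-≡ m)
    (cong (mixed t (phase m m u)) (trans (cong (lag (suc m)) (sym eq)) (lag-factor (suc m) m v))))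
  middle : isZero s ≡ true ⊎ isZero s ≡ false →
           phase (suc m) m (factor (suc m) m v) ≡ suc (mixed t N (lag (suc m) v)) [mod 4 ^ suc m ]
  middle (inj₁ z) with value-wrap s z
  ... | value≡0 , lag≡3 = subst₂ (_≡_[mod 4 ^ suc m ])
    (sym (trans (phase-middle (factor-turn m m a b u (turn-middle m s z))) (cong (mixed t N) value≡0)))
    (cong (λ τ → suc (mixed t N τ)) (sym lag≡3))
    (1 , 0 , wrap-identity t N (4 ^ suc m) (third-spec (suc m)))
  middle (inj₂ z) with phase-factor m ≤-refl u
  ... | c , d , eq = subst₂ (_≡_[mod 4 ^ suc m ])
    (sym (trans (phase-middle (factor-lift m m a b u (turn-middle m s z)))
      (cong (mixed t (phase m m (factor m m u))) (value-rot s z))))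
    refl
    ((2 + 2 * t) * c , 1 + (2 + 2 * t) * d , step-identity t N (phase m m (factor m m u)) (lag (suc m) v) c d
      (4 ^ suc m) (third-spec (suc m)) eq)
... | tri> _ _ m<k with ≤-antisym k≤ m<k
...   | refl =
      subst₂ (_≡_[mod 4 ^ suc (suc m) ]) refl (cong suc (sym (select-> {l = phase m (suc m) u} m<k)))
        (top (isZero? s))
  where
  s = digitSum (2 + m) v
  N = phase m m u
  phase-top : ∀ {a b u} → factor (suc m) (suc m) v ≡ a ∷ b ∷ u →
              phase (suc m) (suc m) (factor (suc m) (suc m) v) ≡ 4 * phase m m u + value s
  phase-top {a} {b} {u} eq =
    trans (cong (phase (suc m) (suc m)) eq) (trans (select-> {l = phase m (suc m) u} m<k)
    (cong (4 * phase m m u +_) (trans (cong (lag (suc m)) (sym eq)) (lag-factor (suc m) (suc m) v))))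
  top : isZero s ≡ true ⊎ isZero s ≡ false →
        phase (suc m) (suc m) (factor (suc m) (suc m) v) ≡ suc (4 * N + lag (suc m) v) [mod 4 ^ suc (suc m) ]
  top (inj₁ z) with value-wrap s z | phase-factor m ≤-refl u
  ... | value≡0 , lag≡3 | c , d , eq = subst₂ (_≡_[mod 4 ^ suc (suc m) ])
    (sym (trans (phase-top (trans (factor-lift m (suc m) a b u (turn-top m s z))
      (cong ((a , b) ▹_) (factor-top m 1 u))))
                (cong (4 * phase m m (factor m m u) +_) value≡0)))
    (cong (λ τ → suc (4 * N + τ)) (sym lag≡3))
    (c , d , carry-identity N _ c d (4 ^ suc m) eq)
  top (inj₂ z) = 0 , 0 , cong (_+ 0) (trans (phase-top (factor-turn m (suc m) a b u (turn-top m s z)))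
    (trans (cong (4 * N +_) (value-rot s z)) (+-suc (4 * N) _)))

-- Residues of phases and distinctness of iterates

≡mod⇒%≡ : ∀ {a b q} D .{{_ : NonZero D}} → D ∣ q → a ≡ b [mod q ] → a % D ≡ b % D
≡mod⇒%≡ {a} {b} D (divides e refl) (c , d , eq) = begin
  a % D                 ≡⟨ [m+kn]%n≡m%n a (c * e) D ⟨
  (a + c * e * D) % D   ≡⟨ cong (λ x → (a + x) % D) (*-assoc c e D) ⟩
  (a + c * (e * D)) % D ≡⟨ cong (_% D) eq ⟩
  (b + d * (e * D)) % D ≡⟨ cong (λ x → (b + x) % D) (*-assoc d e D) ⟨
  (b + d * e * D) % D   ≡⟨ [m+kn]%n≡m%n b (d * e) D ⟩
  b % D                 ∎
  where open ≡-Reasoning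

suc-% : ∀ a D .{{_ : NonZero D}} → suc a % D ≡ suc (a % D) % D
suc-% a D = trans (cong (λ x → suc x % D) (m≡m%n+[m/n]*n a D)) ([m+kn]%n≡m%n (suc (a % D)) (a / D) D)

-- Adding to each sum the other one's quotient times `D` makes the two equal, as the remainders
-- agree; then `p` cancels without subtraction.
+-cancelˡ-% : ∀ D .{{_ : NonZero D}} p {i j} → i < D → j < D → (p + i) % D ≡ (p + j) % D → i ≡ j
+-cancelˡ-% D p {i} {j} i<D j<D eq = begin
  i                     ≡⟨ m<n⇒m%n≡m i<D ⟨
  i % D                 ≡⟨ [m+kn]%n≡m%n i y D ⟨
  (i + y * D) % D       ≡⟨ cong (_% D) (+-cancelˡ-≡ p _ _ shifted) ⟩
  (j + x * D) % D       ≡⟨ [m+kn]%n≡m%n j x D ⟩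
  j % D                 ≡⟨ m<n⇒m%n≡m j<D ⟩
  j                     ∎
  where
  open ≡-Reasoning
  x = (p + i) / D
  y = (p + j) / D
  r = (p + i) % D
  exchange : ∀ r x y → (r + x) + y ≡ (r + y) + x
  exchange = solve-∀
  shifted : p + (i + y * D) ≡ p + (j + x * D)
  shifted = begin
    p + (i + y * D)       ≡⟨ +-assoc p i _ ⟨
    p + i + y * D         ≡⟨ cong (_+ y * D) (m≡m%n+[m/n]*n (p + i) D) ⟩
    r + x * D + y * D     ≡⟨ exchange r (x * D) (y * D) ⟩
    r + y * D + x * D     ≡⟨ cong (λ z → z + y * D + x * D) eq ⟩
    (p + j) % D + y * D + x * D ≡⟨ cong (_+ x * D) (m≡m%n+[m/n]*n (p + j) D) ⟨
    p + j + x * D         ≡⟨ +-assoc p j _ ⟩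
    p + (j + x * D)       ∎

module _ (m : ℕ) {k : ℕ} (k≤m : k ≤ m) (D : ℕ) .{{_ : NonZero D}} (D∣ : D ∣ 4 ^ suc k) where
  phase-step : ∀ v → phase m k (factor m k v) % D ≡ suc (phase m k v) % D
  phase-step v = ≡mod⇒%≡ D D∣ (phase-factor m k≤m v)

  phase-iterate : ∀ v i → phase m k (fold v (factor m k) i) % D ≡ (phase m k v + i) % D
  phase-iterate v zero    = cong (_% D) (sym (+-identityʳ _))
  phase-iterate v (suc i) = begin
    phase m k (factor m k (fold v (factor m k) i)) % D ≡⟨ phase-step (fold v (factor m k) i) ⟩
    suc (phase m k (fold v (factor m k) i)) % D        ≡⟨ suc-% _ D ⟩
    suc (phase m k (fold v (factor m k) i) % D) % D    ≡⟨ cong (λ x → suc x % D) (phase-iterate v i) ⟩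
    suc ((phase m k v + i) % D) % D                    ≡⟨ suc-% _ D ⟨
    suc (phase m k v + i) % D                          ≡⟨ cong (_% D) (+-suc _ i) ⟨
    (phase m k v + suc i) % D                          ∎
    where open ≡-Reasoning

  -- The phase advances by one per step modulo `D`, so the first `D` iterates have distinct
  -- residues.
  iterate-injective : ∀ v {i j} → i < D → j < D → fold v (factor m k) i ≡ fold v (factor m k) j → i ≡ j
  iterate-injective v {i} {j} i<D j<D eq = +-cancelˡ-% D (phase m k v) i<D j<D
    (trans (sym (phase-iterate v i)) (trans (cong (λ w → phase m k w % D) eq) (phase-iterate v j)))

-- Assembling the arcs of the two sheets and the matching

allVertices : ∀ n → List (Vertex n)
allVertices zero    = [] ∷ []
allVertices (suc n) = map (false ∷_) (allVertices n) ++ map (true ∷_) (allVertices n)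

∈-allVertices : ∀ {n} (v : Vertex n) → v ∈ allVertices n
∈-allVertices []          = here refl
∈-allVertices (false ∷ v) = ∈-++⁺ˡ (∈-map⁺ (false ∷_) (∈-allVertices v))
∈-allVertices (true  ∷ v) = ∈-++⁺ʳ (map (false ∷_) (allVertices _)) (∈-map⁺ (true ∷_) (∈-allVertices v))

Label : Set
Label = Maybe (Bool × ℕ)

pattern cross   = nothing
pattern arc ε k = just (ε , k)

joins-twice : ∀ {V : Set} {s t s′ t′ x y : V} → Joins s t x y → Joins s′ t′ x y → Joins s t s′ t′
joins-twice (inj₁ (refl , refl)) (inj₁ (refl , refl)) = inj₁ (refl , refl)
joins-twice (inj₁ (refl , refl)) (inj₂ (refl , refl)) = inj₂ (refl , refl)
joins-twice (inj₂ (refl , refl)) (inj₁ (refl , refl)) = inj₂ (refl , refl)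
joins-twice (inj₂ (refl , refl)) (inj₂ (refl , refl)) = inj₁ (refl , refl)

^-monoʳ-∣ : ∀ b {m n} → m ≤ n → b ^ m ∣ b ^ n
^-monoʳ-∣ b {m} m≤n with m≤n⇒∃[o]m+o≡n m≤n
... | o , refl = subst (b ^ m ∣_) (sym (^-distribˡ-+-* b m o)) (m∣m*n (b ^ o))

-- A wrap would give residue 0, which `suc j` excludes. This lets positions on a cut cycle be
-- followed backwards.
suc-%-inverse : ∀ D .{{_ : NonZero D}} {r j} → r < D → suc r % D ≡ suc j → r ≡ j
suc-%-inverse D {r} r<D eq with m≤n⇒m<n∨m≡n r<D
... | inj₁ 1+r<D = suc-injective (trans (sym (m<n⇒m%n≡m 1+r<D)) eq)
... | inj₂ refl  = contradiction (trans (sym (n%n≡0 (suc r))) eq) λ ()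

-- The sheets false and true are the two copies of the torus.  Labels k < len ε of sheet ε form the paths through
-- the matching (cross), the others are cut along their cycles.
module Assembly (m A B : ℕ) (B≤A : B ≤ A) (A≤1+m : A ≤ suc m)
                (long : 2 * suc (A + B) ∣ 4 ^ suc B) where

  K : ℕ
  K = suc (A + B)

  V : Set
  V = Vertex (suc m * 2)

  Arc : Set
  Arc = Label × V

  len offset : Bool → ℕ
  len false = A
  len true  = B
  offset false = 0
  offset true  = suc A

  B≤len : ∀ ε → B ≤ len ε
  B≤len false = B≤A
  B≤len true  = ≤-refl

  len≤ : ∀ ε → len ε ≤ suc m
  len≤ false = A≤1+m
  len≤ true  = ≤-trans B≤A A≤1+m

  enter′ : ∀ k → Dec (k < A) → Label
  enter′ k (yes _) = arc false k
  enter′ k (no  _) = cross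

  -- The label that follows `k` arcs in sheet `false`. Every path through the matching starts with
  -- label `enter 0`, even for `A = 0`, where that is `cross`.
  enter : ℕ → Label
  enter k = enter′ k (k <? A)

  after : Bool → ℕ → Label
  after false k = enter (suc k)
  -- After the last arc, where `suc k = B`, this arc is no longer on the path; only its source is
  -- used, as the end vertex.
  after true  k = arc true (suc k)

  -- The first arc in sheet `true` comes after the crossing. In sheet `false` the value at `zero` is
  -- a default, for arcs at position 0.
  before : Bool → ℕ → V → Arc
  before ε     (suc k) v = arc ε k , factor⁻¹ m k v
  before _     zero    v = cross , v

  Valid : Arc → Set
  Valid (cross   , _) = ⊤
  Valid (arc ε k , _) = k ≤ m

  valid? : ∀ a → Dec (Valid a)
  valid? (cross   , _) = yes tt
  valid? (arc ε k , _) = k ≤? m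

  src : Arc → Vertex (suc (suc m * 2))
  src (cross   , v) = false ∷ v
  src (arc ε k , v) = ε ∷ v

  pos′ : ∀ ε k → V → Dec (k < len ε) → ℕ
  pos′ ε k v (yes _) = offset ε + k
  pos′ ε k v (no  _) = phase m k v % K

  pos : Arc → ℕ
  pos (cross   , v) = A
  pos (arc ε k , v) = pos′ ε k v (k <? len ε)

  next′ : ∀ ε k → Dec (k < len ε) → Label
  next′ ε k (yes _) = after ε k
  next′ ε k (no  _) = arc ε k

  next : Arc → Arc
  next (cross   , v) = arc true 0 , v
  next (arc ε k , v) = next′ ε k (k <? len ε) , factor m k v

  prev′ : ∀ ε k → V → Dec (k < len ε) → Arc
  prev′ ε k v (yes _) = before ε k v
  prev′ ε k v (no  _) = arc ε k , factor⁻¹ m k v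

  prev : Arc → Arc
  prev (cross   , v) = before false A v
  prev (arc ε k , v) = prev′ ε k v (k <? len ε)

  enter-< : ∀ {k} → k < A → enter k ≡ arc false k
  enter-< {k} k<A with k <? A
  ... | yes _   = refl
  ... | no  k≮A = contradiction k<A k≮A

  enter-end : enter A ≡ cross
  enter-end with A <? A
  ... | yes A<A = contradiction A<A (<-irrefl refl)
  ... | no  _   = refl

  module _ {ε k} (k<len : k < len ε) where
    pos-chain : ∀ v → pos (arc ε k , v) ≡ offset ε + k
    pos-chain v with k <? len ε
    ... | yes _ = refl
    ... | no  ≮ = contradiction k<len ≮

    next-chain : ∀ v → next (arc ε k , v) ≡ (after ε k , factor m k v)
    next-chain v with k <? len ε
    ... | yes _ = refl
    ... | no  ≮ = contradiction k<len ≮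

    prev-chain : ∀ v → prev (arc ε k , v) ≡ before ε k v
    prev-chain v with k <? len ε
    ... | yes _ = refl
    ... | no  ≮ = contradiction k<len ≮

  module _ {ε k} (k≮len : ¬ k < len ε) where
    pos-cycle : ∀ v → pos (arc ε k , v) ≡ phase m k v % K
    pos-cycle v with k <? len ε
    ... | yes k<len = contradiction k<len k≮len
    ... | no  _ = refl

    next-cycle : ∀ v → next (arc ε k , v) ≡ (arc ε k , factor m k v)
    next-cycle v with k <? len ε
    ... | yes k<len = contradiction k<len k≮len
    ... | no  _ = refl

    prev-cycle : ∀ v → prev (arc ε k , v) ≡ (arc ε k , factor⁻¹ m k v)
    prev-cycle v with k <? len ε
    ... | yes k<len = contradiction k<len k≮len
    ... | no  _ = refl

    -- A path with `K` edges has `K + 1` vertices, so distinctness is needed beyond the first `K`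
    -- iterates. The modulus `2 * K` provides it, while `K` alone would let a piece close up.
    2K∣ : 2 * K ∣ 4 ^ suc k
    2K∣ = ∣-trans long (^-monoʳ-∣ 4 (s≤s (≤-trans (B≤len ε) (≮⇒≥ k≮len))))

    K∣ : K ∣ 4 ^ suc k
    K∣ = ∣-trans (n∣m*n 2) 2K∣

    iterate-cycle : ∀ v i → fold (arc ε k , v) next i ≡ (arc ε k , fold v (factor m k) i)
    iterate-cycle v zero    = refl
    iterate-cycle v (suc i) = trans (cong next (iterate-cycle v i)) (next-cycle _)

  -- A change of label does not move the vertex: the source of `cross` still lies in sheet `false`.
  tgt-arc : ∀ ε k v → src (next (arc ε k , v)) ≡ ε ∷ factor m k v
  tgt-arc ε k v with k <? len ε
  ... | no  _ = refl
  tgt-arc true  k v | yes _ = refl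
  tgt-arc false k v | yes _ with suc k <? A
  ... | yes _ = refl
  ... | no  _ = refl

  adjacent : ∀ {a} → Valid a → Adjacent (src a) (src (next a))
  adjacent {cross   , v} _ = Adjacent-head λ ()
  adjacent {arc ε k , v} _ = subst (Adjacent (ε ∷ v)) (sym (tgt-arc ε k v))
    (Adjacent-∷ (succ⇒adjacent (suc m) {v} (factor-succ m k v)))

  cover : ∀ {x y} → Adjacent x y → ∃[ a ] Valid a × Joins (src a) (src (next a)) x y
  cover {ε ∷ v} {ε′ ∷ w} xy with Adjacent-uncons xy
  cover {false ∷ v} {false ∷ w} xy | inj₁ (≢ , _)    = contradiction refl ≢
  cover {false ∷ v} {true  ∷ w} xy | inj₁ (_ , refl) = (cross , v) , tt , inj₁ (refl , refl)
  cover {true  ∷ v} {false ∷ w} xy | inj₁ (_ , refl) = (cross , v) , tt , inj₂ (refl , refl)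
  cover {true  ∷ v} {true  ∷ w} xy | inj₁ (≢ , _)    = contradiction refl ≢
  cover {ε ∷ v} {.ε ∷ w} xy | inj₂ (refl , vw) with adjacent⇒succ (suc m) {v} {w} vw
  ... | inj₁ vw with succ-factor m {v} {w} vw
  ...   | k , k≤m , refl = (arc ε k , v) , k≤m , inj₁ (refl , tgt-arc ε k v)
  cover {ε ∷ v} {.ε ∷ w} xy | inj₂ (refl , _) | inj₂ wv with succ-factor m {w} {v} wv
  ...   | k , k≤m , refl = (arc ε k , w) , k≤m , inj₂ (refl , tgt-arc ε k w)

  -- Matching edges are told apart from the others by the sheets of their ends. Within a sheet,
  -- `factor-injective` settles arcs with the same source and `succ-asym` excludes opposite arcs.
  unique : ∀ {a b x y} → Valid a → Valid b →
           Joins (src a) (src (next a)) x y → Joins (src b) (src (next b)) x y → a ≡ b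
  unique {a} {b} va vb ja jb = same a b va vb (joins-twice ja jb)
    where
    same : ∀ a b → Valid a → Valid b → Joins (src a) (src (next a)) (src b) (src (next b)) → a ≡ b
    same (cross , v) (cross , w) _ _ (inj₁ (refl , _)) = refl
    same (cross , v) (cross , w) _ _ (inj₂ (() , _))
    same (cross , v) (arc ε k , w) _ _ j rewrite tgt-arc ε k w with j
    ... | inj₁ (refl , ())
    ... | inj₂ (refl , ())
    same (arc ε k , v) (cross , w) _ _ j rewrite tgt-arc ε k v with j
    ... | inj₁ (refl , ())
    ... | inj₂ (refl , ())
    same (arc ε k , v) (arc ε′ k′ , w) k≤ k′≤ j rewrite tgt-arc ε k v | tgt-arc ε′ k′ w with j
    ... | inj₁ (refl , eq) = cong (λ k → arc ε k , v) (factor-injective m v k≤ k′≤ (Vec.∷-injectiveʳ eq))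
    ... | inj₂ (eq , eq′) = contradiction
      (subst (Succ (suc m) w) (sym (Vec.∷-injectiveʳ eq)) (factor-succ m k′ w))
      (succ-asym (suc m) {v} {w} (subst (Succ (suc m) v) (Vec.∷-injectiveʳ eq′) (factor-succ m k v)))

  pos<K : ∀ {a} → Valid a → pos a < K
  pos<K {cross , v} _ = s≤s (m≤m+n A B)
  pos<K {arc ε k , v} _ with k <? len ε
  ... | no _ = m%n<n (phase m k v) K
  pos<K {arc false k , v} _ | yes k<A = m≤n⇒m≤1+n (≤-trans k<A (m≤m+n A B))
  pos<K {arc true  k , v} _ | yes k<B = s≤s (+-monoʳ-< A k<B)

  StepTo BackTo : ℕ → Arc → Arc → Set
  StepTo p b a = Valid b × pos b ≡ suc p × prev b ≡ a
  BackTo j b a = Valid b × pos b ≡ j × next b ≡ a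

  step-chain : ∀ ε k v → k < len ε → suc (offset ε + k) < K →
               StepTo (offset ε + k) (after ε k , factor m k v) (arc ε k , v)
  step-chain true k v _ (s≤s p<) =
    <⇒≤pred (≤-trans 1+k<B (len≤ true)) ,
    trans (pos-chain {true} 1+k<B (factor m k v)) (cong suc (+-suc A k)) ,
    trans (prev-chain {true} 1+k<B (factor m k v)) (cong (arc true k ,_) (factor⁻¹-factor m k v))
    where
    1+k<B : suc k < B
    1+k<B = +-cancelˡ-< A (suc k) B (subst (_< A + B) (sym (+-suc A k)) p<)
  step-chain false k v k<A _ with suc k <? A
  ... | yes 1+k<A =
    <⇒≤pred (≤-trans 1+k<A A≤1+m) ,
    pos-chain {false} 1+k<A (factor m k v) ,
    trans (prev-chain {false} 1+k<A (factor m k v)) (cong (arc false k ,_) (factor⁻¹-factor m k v))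
  ... | no 1+k≮A =
    tt , A≡ ,
    trans (cong (λ l → before false l (factor m k v)) A≡) (cong (arc false k ,_) (factor⁻¹-factor m k v))
    where
    A≡ : A ≡ suc k
    A≡ = ≤-antisym (≮⇒≥ 1+k≮A) k<A

  step : ∀ {a} → Valid a → suc (pos a) < K → StepTo (pos a) (next a) a
  step {cross , v} _ (s≤s A<) =
    z≤n , trans (pos-chain {true} 0<B v) (+-identityʳ (suc A)) , prev-chain {true} 0<B v
    where
    0<B : 0 < B
    0<B = +-cancelˡ-< A 0 B (subst (_< A + B) (sym (+-identityʳ A)) A<)
  step {a@(arc ε k , v)} k≤m p< = case k <? len ε of λ
    { (yes k<len) → subst₂ (λ p b → StepTo p b a) (sym (pos-chain k<len v)) (sym (next-chain k<len v))
        (step-chain ε k v k<len (subst (λ p → suc p < K) (pos-chain k<len v) p<))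
    ; (no k≮len) → subst₂ (λ p b → StepTo p b a) (sym (pos-cycle k≮len v)) (sym (next-cycle k≮len v))
        ( k≤m
        , trans (pos-cycle k≮len (factor m k v))
            (trans (phase-step m k≤m K (K∣ k≮len) v) (trans (suc-% (phase m k v) K)
              -- Before the last position the residue does not wrap.
              (m<n⇒m%n≡m (subst (λ p → suc p < K) (pos-cycle k≮len v) p<))))
        , trans (prev-cycle k≮len (factor m k v)) (cong (arc ε k ,_) (factor⁻¹-factor m k v)))
    }

  back-chain : ∀ ε k v {j} → k < len ε → offset ε + k ≡ suc j → BackTo j (before ε k v) (arc ε k , v)
  back-chain false (suc k) v k<A refl =
    <⇒≤ (<⇒≤pred (≤-trans k<A A≤1+m)) ,
    pos-chain {false} (<⇒≤ k<A) (factor⁻¹ m k v) ,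
    trans (next-chain {false} (<⇒≤ k<A) (factor⁻¹ m k v)) (cong₂ _,_ (enter-< k<A) (factor-factor⁻¹ m k v))
  back-chain true zero v _ eq = tt , trans (sym (+-identityʳ A)) (suc-injective eq) , refl
  back-chain true (suc k) v k<B eq =
    <⇒≤ (<⇒≤pred (≤-trans k<B (len≤ true))) ,
    trans (pos-chain {true} (<⇒≤ k<B) (factor⁻¹ m k v)) (trans (sym (+-suc A k)) (suc-injective eq)) ,
    trans (next-chain {true} (<⇒≤ k<B) (factor⁻¹ m k v)) (cong (arc true (suc k) ,_) (factor-factor⁻¹ m k v))

  back-cross : ∀ v {j} → A ≡ suc j → BackTo j (before false (suc j) v) (cross , v)
  back-cross v {j} A≡ =
    <⇒≤pred (subst (_≤ suc m) A≡ A≤1+m) ,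
    pos-chain {false} j<A (factor⁻¹ m j v) ,
    trans (next-chain {false} j<A (factor⁻¹ m j v))
      (cong₂ _,_ (trans (cong enter (sym A≡)) enter-end) (factor-factor⁻¹ m j v))
    where
    j<A : j < A
    j<A = ≤-reflexive (sym A≡)

  back : ∀ {a j} → Valid a → pos a ≡ suc j → BackTo j (prev a) a
  back {cross , v} {j} _ A≡ = subst (λ l → BackTo j (before false l v) (cross , v)) (sym A≡) (back-cross v A≡)
  back {a@(arc ε k , v)} {j} k≤m p≡ = case k <? len ε of λ
    { (yes k<len) → subst (λ b → BackTo j b a) (sym (prev-chain k<len v))
        (back-chain ε k v k<len (trans (sym (pos-chain k<len v)) p≡))
    ; (no k≮len) → subst (λ b → BackTo j b a) (sym (prev-cycle k≮len v))
        ( k≤m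
        , trans (pos-cycle k≮len w) (suc-%-inverse K (m%n<n (phase m k w) K)
            (trans (sym (trans (phase-step m k≤m K (K∣ k≮len) w) (suc-% (phase m k w) K)))
              (trans (cong (λ u → phase m k u % K) (factor-factor⁻¹ m k v))
                (trans (sym (pos-cycle k≮len v)) p≡))))
        , trans (next-cycle k≮len w) (cong (arc ε k ,_) (factor-factor⁻¹ m k v)))
    }
    where
    w = factor⁻¹ m k v

  module _ (v : V) where
    turningPoint : V
    turningPoint = trail m v A

    fold-enter : ∀ {i} → i ≤ A → fold (enter 0 , v) next i ≡ (enter i , trail m v i)
    fold-enter {zero}  _   = refl
    fold-enter {suc i} i<A =
      trans (cong next (trans (fold-enter (<⇒≤ i<A)) (cong (_, trail m v i) (enter-< i<A))))
                                   (next-chain {false} i<A (trail m v i))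

    -- In sheet `true` the labels start again from 0, so the second half is a trail of its own. The
    -- index is written `suc (j + A)` so that `fold` computes by recursion on `j`.
    fold-leave : ∀ {j} → j ≤ B → fold (enter 0 , v) next (suc (j + A)) ≡ (arc true j , trail m turningPoint j)
    fold-leave {zero}  _   = cong next (trans (fold-enter ≤-refl) (cong (_, turningPoint) enter-end))
    fold-leave {suc j} j<B =
      trans (cong next (fold-leave (<⇒≤ j<B))) (next-chain {true} j<B (trail m turningPoint j))

    src-enter : ∀ k w → src (enter k , w) ≡ false ∷ w
    src-enter k w with k <? A
    ... | yes _ = refl
    ... | no  _ = refl

    Position : ℕ → Set
    Position i = (i ≤ A × src (fold (enter 0 , v) next i) ≡ false ∷ trail m v i)
               ⊎ (∃[ j ] suc (j + A) ≡ i × j ≤ B × src (fold (enter 0 , v) next i) ≡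
                   true ∷ trail m turningPoint j)

    position : ∀ {i} → i ≤ K → Position i
    position {i} i≤K with i ≤? A
    ... | yes i≤A = inj₁ (i≤A , trans (cong src (fold-enter i≤A)) (src-enter i (trail m v i)))
    ... | no  i≰A with m≤n⇒∃[o]m+o≡n (≰⇒> i≰A)
    ...   | j , eq = inj₂ (j , trans (cong suc (+-comm j A)) eq , j≤B ,
                           trans (cong (src ∘ fold (enter 0 , v) next)
                             (trans (sym eq) (cong suc (+-comm A j))))
                                 (cong src (fold-leave j≤B)))
      where
      j≤B : j ≤ B
      j≤B = +-cancelˡ-≤ A j B (<⇒≤pred (subst (_≤ K) (sym eq) i≤K))

    -- The leading bit separates the two halves of the path, and each half is a trail.
    chain-simple : ∀ {i j} → i ≤ K → j ≤ K →
                   src (fold (enter 0 , v) next i) ≡ src (fold (enter 0 , v) next j) → i ≡ j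
    chain-simple i≤ j≤ eq with position i≤ | position j≤
    ... | inj₁ (i≤A , p) | inj₁ (j≤A , q) =
          trail-injective m v (m≤n⇒m≤1+n (≤-trans i≤A A≤1+m)) (m≤n⇒m≤1+n (≤-trans j≤A A≤1+m))
            (Vec.∷-injectiveʳ (trans (sym p) (trans eq q)))
    ... | inj₁ (_ , p) | inj₂ (_ , _ , _ , q) =
          contradiction (Vec.∷-injectiveˡ (trans (sym p) (trans eq q))) λ ()
    ... | inj₂ (_ , _ , _ , p) | inj₁ (_ , q) =
          contradiction (Vec.∷-injectiveˡ (trans (sym p) (trans eq q))) λ ()
    ... | inj₂ (x , refl , x≤B , p) | inj₂ (y , refl , y≤B , q) = cong (λ z → suc (z + A))
          (trail-injective m turningPoint (m≤n⇒m≤1+n (≤-trans x≤B (len≤ true)))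
            (m≤n⇒m≤1+n (≤-trans y≤B (len≤ true)))
            (Vec.∷-injectiveʳ (trans (sym p) (trans eq q))))

  simple : ∀ {a i j} → Valid a → pos a ≡ 0 → i ≤ K → j ≤ K → src (fold a next i) ≡ src (fold a next j) → i ≡ j
  simple {cross , v} {i} {j} _ A≡0 i≤ j≤ eq =
    chain-simple v i≤ j≤ (subst (λ l → src (fold (l , v) next i) ≡ src (fold (l , v) next j))
      (sym (trans (cong enter (sym A≡0)) enter-end)) eq)
  simple {arc ε k , v} {i} {j} k≤m p≡0 i≤ j≤ eq = case k <? len ε of λ
    { (yes k<len) → chain ε k<len (trans (sym (pos-chain k<len v)) p≡0) eq
    ; (no k≮len) → iterate-injective m k≤m (2 * K) (2K∣ k≮len) v (<2K i≤) (<2K j≤)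
        (Vec.∷-injectiveʳ (trans (sym (cong src (iterate-cycle k≮len v i)))
          (trans eq (cong src (iterate-cycle k≮len v j)))))
    }
    where
    <2K : ∀ {i} → i ≤ K → i < 2 * K
    <2K {i} i≤K = subst (i <_) (*-comm K 2) (≤-<-trans i≤K (m<m*n K 2 ≤-refl))
    -- Position 0 occurs only at label 0 of sheet `false`; positions in sheet `true` are at least
    -- `suc A`.
    chain : ∀ ε {k} → k < len ε → offset ε + k ≡ 0 →
            src (fold (arc ε k , v) next i) ≡ src (fold (arc ε k , v) next j) → i ≡ j
    chain false 0<A refl eq = chain-simple v i≤ j≤
      (subst (λ l → src (fold (l , v) next i) ≡ src (fold (l , v) next j)) (sym (enter-< 0<A)) eq)

  labels : List Label
  labels = cross ∷ map just (cartesianProduct (false ∷ true ∷ []) (upTo (suc m)))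

  arcs-complete : ∀ {a} → Valid a → a ∈ cartesianProduct labels (allVertices (suc m * 2))
  arcs-complete {cross   , v} _   = ∈-cartesianProduct⁺ {xs = labels} (here refl) (∈-allVertices v)
  arcs-complete {arc ε k , v} k≤m =
    ∈-cartesianProduct⁺ {xs = labels}
      (there (∈-map⁺ just (∈-cartesianProduct⁺ (∈-sheets ε) (∈-upTo⁺ (s≤s k≤m))))) (∈-allVertices v)
    where
    ∈-sheets : ∀ ε → ε ∈ false ∷ true ∷ []
    ∈-sheets false = here refl
    ∈-sheets true  = there (here refl)

  arcDecomposition : ArcDecomposition (suc (suc m * 2)) K
  arcDecomposition = record
    { Arc = Arc
    ; _≟ₐ_ = Product.≡-dec (Maybe.≡-dec (Product.≡-dec Bool._≟_ _≟_)) (Vec.≡-dec Bool._≟_)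
    ; Valid = Valid
    ; valid? = valid?
    ; arcs = cartesianProduct labels (allVertices (suc m * 2))
    ; arcs-complete = arcs-complete
    ; src = src
    ; next = next
    ; prev = prev
    ; pos = pos
    ; adjacent = adjacent
    ; cover = cover
    ; unique = unique
    ; pos<k = pos<K
    ; step = step
    ; back = back
    ; simple = simple
    }

-- Choice of the parameters

n<2^n : ∀ n → n < 2 ^ n
n<2^n zero    = s≤s z≤n
n<2^n (suc n) = begin-strict
  suc n           <⟨ s≤s (n<2^n n) ⟩
  1 + 2 ^ n       ≤⟨ +-monoˡ-≤ (2 ^ n) (m^n>0 2 n) ⟩
  2 ^ n + 2 ^ n   ≡⟨ cong (2 ^ n +_) (+-identityʳ (2 ^ n)) ⟨
  2 ^ suc n       ∎
  where open ≤-Reasoning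

hypercube-odd : ∀ m r → 2 ^ r ≤ 2 * suc m → HasPathDecomposition (suc (suc m * 2)) (2 ^ r)
hypercube-odd m zero _ = arcDecomposition⇒pathDecomposition
  (Assembly.arcDecomposition m 0 0 z≤n z≤n (divides 2 refl))
hypercube-odd m (suc r) 2^r≤ with 2 ^ r in half | n<2^n r
... | suc B | r≤B = subst (HasPathDecomposition _) K≡
      (arcDecomposition⇒pathDecomposition
        (Assembly.arcDecomposition m (suc B) B (n≤1+n B) (*-cancelˡ-≤ 2 2^r≤) long))
  where
  K≡ : suc (suc B + B) ≡ 2 * suc B
  K≡ = trans (sym (+-suc (suc B) B)) (cong (suc B +_) (sym (+-identityʳ (suc B))))
  -- The left side is `2 ^ (r + 2)` and the right side `2 ^ (2 * suc B)`, so `r + 2 ≤ 2 * suc B`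
  -- suffices; it follows from `r < 2 ^ r = suc B`.
  long : 2 * suc (suc B + B) ∣ 4 ^ suc B
  long = subst₂ _∣_ (cong (2 *_) (trans (cong (2 *_) half) (sym K≡))) (sym (^-*-assoc 2 2 (suc B)))
    (^-monoʳ-∣ 2 {suc (suc r)} {2 * suc B} (subst (suc (suc r) ≤_) K≡ (s≤s (≤-trans r≤B (m≤m+n (suc B) B)))))

theorem2p5 : (n r : ℕ) → (t : ℕ) → n ≡ suc (2 * t) → 2 ^ r < n → HasPathDecomposition n (2 ^ r)
theorem2p5 _ r zero    refl 2^r<1 = contradiction (m^n>0 2 r) (<⇒≱ 2^r<1)
theorem2p5 _ r (suc m) refl 2^r<n =
  subst (λ d → HasPathDecomposition (suc d) (2 ^ r)) (*-comm (suc m) 2) (hypercube-odd m r (<⇒≤pred 2^r<n))
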